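{- Let $T$ be a finite tree. Then determining sets have the exchange property in $T$: whenever $S$ and $R$ are minimal determining sets of $T$ and $r\in R$, there exists $s\in S$ such that $(S\setminus\{s\})\cup\{r\}$ is a minimal determining set of $T$.
   Context: A set $S\subseteq V(G)$ of a graph $G$ is a determining set if whenever $g,h\in\mathrm{Aut}(G)$ satisfy $g(s)=h(s)$ for all $s\in S$, then $g=h$ (equivalently, the only automorphism fixing every vertex of $S$ is the identity). A minimal determining set is a determining set none of whose proper subsets is a determining set. -}

module Defs where

open import Data.Nat using (ℕ; suc; _≤_)
open import Data.Fin using (Fin)
open import Data.Fin.Subset using (Subset; _∈_; _⊂_)
open import Data.Bool using (Bool; true; false)
open import Data.List using (List; []; _∷_; length)
open import Data.List.Relation.Unary.Unique.Propositional using (Unique)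
open import Data.Product using (Σ; _×_; _,_)
open import Data.Unit using (⊤)
open import Function.Bundles using (_↔_; Inverse)
open import Relation.Binary.PropositionalEquality using (_≡_)
open import Relation.Nullary using (¬_)

record Graph (n : ℕ) : Set where
  field
    adj    : Fin n → Fin n → Bool
    sym    : ∀ u v → adj u v ≡ adj v u
    irrefl : ∀ v → adj v v ≡ false

open Graph public

Adj : ∀ {n} → Graph n → Fin n → Fin n → Set
Adj G u v = adj G u v ≡ true

data Walk {n} (G : Graph n) : Fin n → Fin n → Set where
  here : ∀ v → Walk G v v
  step : ∀ {u w v} → Adj G u w → Walk G w v → Walk G u v

Connected : ∀ {n} → Graph n → Set
Connected G = ∀ u v → Walk G u v

Chain : ∀ {n} → Graph n → Fin n → List (Fin n) → Set
Chain G u []       = ⊤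
Chain G u (w ∷ ws) = Adj G u w × Chain G w ws

last : ∀ {A : Set} → A → List A → A
last v []       = v
last v (w ∷ ws) = last w ws

IsCycle : ∀ {n} → Graph n → Fin n → List (Fin n) → Set
IsCycle G v vs = Unique (v ∷ vs) × (2 ≤ length vs) × Chain G v vs × Adj G (last v vs) v

Acyclic : ∀ {n} → Graph n → Set
Acyclic G = ∀ v vs → ¬ IsCycle G v vs

IsTree : ∀ {n} → Graph n → Set
IsTree {n} G = (1 ≤ n) × Connected G × Acyclic G

record Aut {n} (G : Graph n) : Set where
  field
    perm     : Fin n ↔ Fin n
    preserve : ∀ u v → adj G (Inverse.to perm u) (Inverse.to perm v) ≡ adj G u v

open Aut public

apply : ∀ {n} {G : Graph n} → Aut G → Fin n → Fin n
apply g = Inverse.to (perm g)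

IsDetermining : ∀ {n} → Graph n → Subset n → Set
IsDetermining {n} G S =
  ∀ (g h : Aut G) → (∀ s → s ∈ S → apply g s ≡ apply h s) → ∀ v → apply g v ≡ apply h v

IsMinDetermining : ∀ {n} → Graph n → Subset n → Set
IsMinDetermining G S = IsDetermining G S × (∀ S′ → S′ ⊂ S → ¬ IsDetermining G S′)

{-# OPTIONS --safe #-}
module Submission where

open import Defs
open import Data.Nat using (ℕ; zero; suc; _≤_; z≤n; s≤s)
open import Data.Nat.Properties using (n<1+n)
open import Data.Bool.Properties using (⇔→≡) renaming (_≟_ to _≟ᵇ_)
open import Data.Fin using (Fin; zero; suc; toℕ; _≟_)
open import Data.Fin.Properties using (all?; any?; ¬∀⟶∃¬; pigeonhole)
open import Data.Fin.Subset using (Subset; inside; outside; _∈_; _∉_; _⊂_; _∪_; _─_; _-_; ⁅_⁆)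
open import Data.Fin.Subset.Induction using (⊂-wellFounded)
open import Data.Fin.Subset.Properties using (_∈?_; x∈⁅x⁆; x∈⁅y⁆⇒x≡y; x∈p∪q⁺; x∈p∪q⁻; p─q⊆p; x∈p∧x≢y⇒x∈p-y; x∈p⇒p-x⊂p)
open import Data.List using ([]; _∷_)
open import Data.List.Membership.DecPropositional using () renaming (_∈?_ to _∈ˡ?_)
open import Data.List.Membership.Propositional using () renaming (_∈_ to _∈ˡ_)
open import Data.List.Relation.Unary.All using (All; []; _∷_)
open import Data.List.Relation.Unary.All.Properties using (¬Any⇒All¬)
open import Data.List.Relation.Unary.AllPairs using ([]; _∷_)
open import Data.List.Relation.Unary.Any using (here; there)
open import Data.List.Relation.Unary.Unique.Propositional using (Unique)
open import Data.Product using (Σ; ∃; _×_; _,_; proj₁; proj₂)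
open import Data.Sum using (_⊎_; inj₁; inj₂)
open import Data.Unit using (tt)
open import Data.Vec using (Vec; []; _∷_; lookup; tabulate; here; there)
open import Data.Vec.Properties using (lookup∘tabulate; lookup⇒[]=; []=⇒lookup)
open import Function using (_∘_; id)
open import Function.Bundles using (Inverse; mk⇔; mk↔ₛ′)
open import Induction.WellFounded using (Acc; acc)
open import Relation.Binary.Construct.Closure.ReflexiveTransitive using (Star; ε; _◅_; _◅◅_; gmap; reverse)
open import Relation.Binary.PropositionalEquality using (_≡_; _≢_; refl; trans; cong; cong₂; subst; ≢-sym) renaming (sym to ≡-sym)
open import Relation.Nullary using (¬_; Dec; yes; no; does; contradiction)
open import Relation.Nullary.Decidable using (map′; _×-dec_; _→-dec_; ¬?; decidable-stable; dec-true)

-- For an edge (v , c), let B be the component of c after deleting the edge.  An automorphism g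
-- that fixes R - r but moves r yields, at the centre of the path from r to g r, an edge for which
-- r ∈ B and g B is disjoint from B; there g fixes v or inverts the edge.  An automorphism h fixing
-- a vertex of B fixes v and c.  As R is determining, the conjugate by g of h restricted to B is
-- trivial, so all vertices of B have the same stabiliser; similarly g merely swaps B and g B.
-- Hence a vertex s ∈ S moved by g lies in B or g s does.  If some s ∈ S lies in B, it has the
-- stabiliser of r and r may replace it.  Otherwise s is the only vertex of S moved by g, and r may
-- replace g s in the minimal determining set g S = (S - s) ∪ ⁅ g s ⁆.

-- Finite subsets and exhaustive search

x∈p─q⇒x∉q : ∀ {n} {x : Fin n} (p q : Subset n) → x ∈ p ─ q → x ∉ q
x∈p─q⇒x∉q (inside ∷ p) (outside ∷ q) here ()
x∈p─q⇒x∉q (_ ∷ p) (_ ∷ q) (there x∈) (there x∈q) = x∈p─q⇒x∉q p q x∈ x∈q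

x∈p-y⇒x≢y : ∀ {n} {x y : Fin n} (p : Subset n) → x ∈ p - y → x ≢ y
x∈p-y⇒x≢y p x∈ refl = x∈p─q⇒x∉q p ⁅ _ ⁆ x∈ (x∈⁅x⁆ _)

any-vec? : ∀ {m} k {P : Vec (Fin m) k → Set} → (∀ xs → Dec (P xs)) → Dec (∃ P)
any-vec? zero    P? = map′ ([] ,_) (λ { ([] , p) → p }) (P? [])
any-vec? (suc k) P? =
  map′ (λ { (x , xs , p) → x ∷ xs , p }) (λ { (x ∷ xs , p) → x , xs , p })
       (any? λ x → any-vec? k λ xs → P? (x ∷ xs))

⟦_⟧ : ∀ {n} {P : Fin n → Set} → (∀ x → Dec (P x)) → Subset n
⟦ P? ⟧ = tabulate (does ∘ P?)

module _ {n} {P : Fin n → Set} (P? : ∀ x → Dec (P x)) where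

  ∈⟦⟧⁺ : ∀ {x} → P x → x ∈ ⟦ P? ⟧
  ∈⟦⟧⁺ {x} p = lookup⇒[]= x _ (trans (lookup∘tabulate _ x) (dec-true (P? x) p))

  ∈⟦⟧⁻ : ∀ {x} → x ∈ ⟦ P? ⟧ → P x
  ∈⟦⟧⁻ {x} x∈ with P? x | trans (≡-sym (lookup∘tabulate (does ∘ P?) x)) ([]=⇒lookup x∈)
  ... | yes p | _ = p

-- Injective self-maps of a finite set

iterate : ∀ {A : Set} → (A → A) → ℕ → A → A
iterate f zero    x = x
iterate f (suc k) x = f (iterate f k x)

module _ {n} {f : Fin n → Fin n} (f-injective : ∀ {x y} → f x ≡ f y → x ≡ y) where

  private
    periodic : ∀ x i j → suc i ≤ j → iterate f i x ≡ iterate f j x →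
               ∃ λ k → iterate f (suc k) x ≡ x
    periodic x zero    (suc j) _         eq = j , ≡-sym eq
    periodic x (suc i) (suc j) (s≤s i<j) eq = periodic x i j i<j (f-injective eq)

  injective⇒periodic : ∀ x → ∃ λ k → iterate f (suc k) x ≡ x
  injective⇒periodic x
    with i , j , i<j , eq ← pigeonhole (n<1+n n) (λ i → iterate f (toℕ i) x)
    = periodic x (toℕ i) (toℕ j) i<j eq

  iterate-suc : ∀ k x → iterate f (suc k) x ≡ iterate f k (f x)
  iterate-suc zero    x = refl
  iterate-suc (suc k) x = cong f (iterate-suc k x)

  -- By periodicity `x` is itself an iterate of `f x`, so forward closure already reaches it. In
  -- later uses this says that an automorphism mapping a half into itself maps it onto itself.
  closed⇒closed⁻¹ : (P : Fin n → Set) → (∀ x → P x → P (f x)) → ∀ x → P (f x) → P x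
  closed⇒closed⁻¹ P closed x p
    with k , eq ← injective⇒periodic x
    = subst P (trans (≡-sym (iterate-suc k x)) eq) (go k)
    where
    go : ∀ k → P (iterate f k (f x))
    go zero    = p
    go (suc k) = closed _ (go k)

-- Automorphisms, stabilisers and determining sets

module Automorphisms {n} (G : Graph n) where

  infixr 9 _·_
  _·_ : Aut G → Fin n → Fin n
  g · x = apply g x

  ι : Aut G
  ι = record { perm = mk↔ₛ′ id id (λ _ → refl) (λ _ → refl) ; preserve = λ _ _ → refl }

  mkAut : (f f⁻¹ : Fin n → Fin n) → (∀ x → f (f⁻¹ x) ≡ x) → (∀ x → f⁻¹ (f x) ≡ x) →
          (∀ {x y} → Adj G x y → Adj G (f x) (f y)) →
          (∀ {x y} → Adj G x y → Adj G (f⁻¹ x) (f⁻¹ y)) → Aut G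
  mkAut f f⁻¹ invˡ invʳ f-adj f⁻¹-adj = record
    { perm     = mk↔ₛ′ f f⁻¹ invˡ invʳ
    ; preserve = λ u v → ⇔→≡ (mk⇔ (λ a → subst₂ (invʳ u) (invʳ v) (f⁻¹-adj a)) f-adj)
    }
    where
    subst₂ : ∀ {x y x′ y′} → x ≡ x′ → y ≡ y′ → Adj G x y → Adj G x′ y′
    subst₂ refl refl a = a

  ·-adj : ∀ g {x y} → Adj G x y → Adj G (g · x) (g · y)
  ·-adj g a = trans (preserve g _ _) a

  infix 10 _⁻¹
  _⁻¹ : Aut G → Aut G
  g ⁻¹ = mkAut from (apply g) strictlyInverseʳ strictlyInverseˡ
    (λ {x} {y} a → trans (≡-sym (preserve g _ _)) (trans (cong₂ (adj G) (strictlyInverseˡ x) (strictlyInverseˡ y)) a))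
    (·-adj g)
    where open Inverse (perm g)

  infixr 9 _⊙_
  _⊙_ : Aut G → Aut G → Aut G
  g ⊙ h = mkAut (λ x → g · h · x) (λ x → h ⁻¹ · g ⁻¹ · x)
    (λ x → trans (cong (apply g) (strictlyInverseˡ (perm h) _)) (strictlyInverseˡ (perm g) x))
    (λ x → trans (cong (Inverse.from (perm h)) (strictlyInverseʳ (perm g) _)) (strictlyInverseʳ (perm h) x))
    (·-adj g ∘ ·-adj h) (·-adj (h ⁻¹) ∘ ·-adj (g ⁻¹))
    where open Inverse

  ⁻¹-· : ∀ g x → g ⁻¹ · g · x ≡ x
  ⁻¹-· g = Inverse.strictlyInverseʳ (perm g)

  ·-⁻¹ : ∀ g x → g · g ⁻¹ · x ≡ x
  ·-⁻¹ g = Inverse.strictlyInverseˡ (perm g)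

  ·-injective : ∀ g {x y} → g · x ≡ g · y → x ≡ y
  ·-injective g {x} {y} eq = trans (≡-sym (⁻¹-· g x)) (trans (cong (g ⁻¹ ·_) eq) (⁻¹-· g y))

  fix⇒fix⁻¹ : ∀ g {x} → g · x ≡ x → g ⁻¹ · x ≡ x
  fix⇒fix⁻¹ g {x} eq = trans (cong (g ⁻¹ ·_) (≡-sym eq)) (⁻¹-· g x)

  _fixes_ : Aut G → Subset n → Set
  g fixes S = ∀ x → x ∈ S → g · x ≡ x

  determining⇒trivial : ∀ {S} → IsDetermining G S → ∀ h → h fixes S → ∀ x → h · x ≡ x
  determining⇒trivial det h fix = det h ι fix

  trivial⇒determining : ∀ {S} → (∀ h → h fixes S → ∀ x → h · x ≡ x) → IsDetermining G S
  trivial⇒determining triv g h eq x =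
    trans (≡-sym (·-⁻¹ h _))
          (cong (h ·_) (triv (h ⁻¹ ⊙ g) (λ s s∈ → trans (cong (h ⁻¹ ·_) (eq s s∈)) (⁻¹-· h s)) x))

  SameStabiliser : Fin n → Fin n → Set
  SameStabiliser x y = ∀ h → (h · x ≡ x → h · y ≡ y) × (h · y ≡ y → h · x ≡ x)

  -- As `g` fixes `S - s`, it carries `S` to `(S - s) ∪ ⁅ g · s ⁆`, and conjugation by `g` carries
  -- minimality along. Only the stabilisers of the members matter, so `r` may stand in for `g · s`.
  exchange : ∀ {S s r} → IsMinDetermining G S → s ∈ S →
             ∀ g → g fixes (S - s) → SameStabiliser (g · s) r →
             IsMinDetermining G ((S - s) ∪ ⁅ r ⁆)
  exchange {S} {s} {r} (det , min) s∈S g g-fix same = trivial⇒determining det′ , min′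
    where
    S′ = (S - s) ∪ ⁅ r ⁆

    det′ : ∀ h → h fixes S′ → ∀ x → h · x ≡ x
    det′ h fix x = trans (cong (h ·_) (≡-sym (·-⁻¹ g x)))
                         (trans (≡-sym (·-⁻¹ g _)) (trans (cong (g ·_) (conj-trivial (g ⁻¹ · x))) (·-⁻¹ g x)))
      where
      conj-fix : (g ⁻¹ ⊙ h ⊙ g) fixes S
      conj-fix y y∈ with y ≟ s
      ... | yes refl = trans (cong (g ⁻¹ ·_) (proj₂ (same h) (fix r (x∈p∪q⁺ (inj₂ (x∈⁅x⁆ r)))))) (⁻¹-· g y)
      ... | no y≢s =
        let y∈′ = x∈p∧x≢y⇒x∈p-y y∈ y≢s
            gy  = g-fix y y∈′
        in trans (cong (g ⁻¹ ·_) (trans (cong (h ·_) gy) (fix y (x∈p∪q⁺ (inj₁ y∈′))))) (fix⇒fix⁻¹ g gy)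
      conj-trivial = determining⇒trivial det (g ⁻¹ ⊙ h ⊙ g) conj-fix

    min′ : ∀ S″ → S″ ⊂ S′ → ¬ IsDetermining G S″
    min′ S″ (S″⊆ , x , x∈S′ , x∉S″) det″ with x ≟ r
    -- Without `r`, the set `S″` lies inside `S - s`.
    ... | yes refl = min (S - s) (x∈p⇒p-x⊂p s∈S) (trivial⇒determining λ h fix →
            determining⇒trivial det″ h (λ y y∈ → fix y (in-S-s y y∈)))
      where
      in-S-s : ∀ y → y ∈ S″ → y ∈ S - s
      in-S-s y y∈ with x∈p∪q⁻ (S - s) ⁅ r ⁆ (S″⊆ y∈)
      ... | inj₁ y∈′ = y∈′
      ... | inj₂ y∈r with refl ← x∈⁅y⁆⇒x≡y r y∈r = contradiction y∈ x∉S″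
    -- Here `x` is in `S - s`; if `h` fixes `S - x`, its conjugate by `g` fixes `g · s`, hence `r`,
    -- and so all of `S″`.
    ... | no x≢r = min (S - x) (x∈p⇒p-x⊂p x∈S) (trivial⇒determining λ h fix y →
            ·-injective g (trans (cong (λ z → g · h · z) (≡-sym (⁻¹-· g y)))
              (determining⇒trivial det″ (g ⊙ h ⊙ g ⁻¹) (conj-fix h fix) (g · y))))
      where
      x∈S-s : x ∈ S - s
      x∈S-s with x∈p∪q⁻ (S - s) ⁅ r ⁆ x∈S′
      ... | inj₁ x∈ = x∈
      ... | inj₂ x∈r = contradiction (x∈⁅y⁆⇒x≡y r x∈r) x≢r
      x∈S = p─q⊆p S ⁅ s ⁆ x∈S-s
      s≢x = ≢-sym (x∈p-y⇒x≢y S x∈S-s)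
      conj-fix : ∀ h → h fixes (S - x) → (g ⊙ h ⊙ g ⁻¹) fixes S″
      conj-fix h fix y y∈ with x∈p∪q⁻ (S - s) ⁅ r ⁆ (S″⊆ y∈)
      ... | inj₂ y∈r with refl ← x∈⁅y⁆⇒x≡y r y∈r =
        proj₁ (same (g ⊙ h ⊙ g ⁻¹))
          (cong (g ·_) (trans (cong (h ·_) (⁻¹-· g s)) (fix s (x∈p∧x≢y⇒x∈p-y s∈S s≢x))))
      ... | inj₁ y∈S-s =
        let gy = g-fix y y∈S-s
            y≢x = λ y≡x → x∉S″ (subst (_∈ S″) y≡x y∈)
        in trans (cong (g ·_) (trans (cong (h ·_) (fix⇒fix⁻¹ g gy))
                   (fix y (x∈p∧x≢y⇒x∈p-y (p─q⊆p S ⁅ s ⁆ y∈S-s) y≢x)))) gy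

  moved-vertex : ∀ g S → ¬ (g fixes S) → ∃ λ s → s ∈ S × g · s ≢ s
  moved-vertex g S ¬fix
    with s , ¬p ← ¬∀⟶∃¬ n _ (λ x → (x ∈? S) →-dec (g · x ≟ x)) ¬fix
    = s , decidable-stable (s ∈? S) (λ s∉ → ¬p λ s∈ → contradiction s∈ s∉) , λ eq → ¬p λ _ → eq

  private
    -- A map and its inverse are stored as vectors of values: every clause is then decidable and
    -- there are finitely many candidates.
    IsAutFixing : Subset n → Vec (Fin n) n → Vec (Fin n) n → Set
    IsAutFixing S xs ys =
        (∀ x → lookup xs (lookup ys x) ≡ x)
      × (∀ x → lookup ys (lookup xs x) ≡ x)
      × (∀ x y → adj G (lookup xs x) (lookup xs y) ≡ adj G x y)
      × (∀ x → x ∈ S → lookup xs x ≡ x)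
      × ¬ (∀ x → lookup xs x ≡ x)

    isAutFixing? : ∀ S xs ys → Dec (IsAutFixing S xs ys)
    isAutFixing? S xs ys =
      (all? λ x → lookup xs (lookup ys x) ≟ x) ×-dec
      (all? λ x → lookup ys (lookup xs x) ≟ x) ×-dec
      (all? λ x → all? λ y → adj G (lookup xs x) (lookup xs y) ≟ᵇ adj G x y) ×-dec
      (all? λ x → (x ∈? S) →-dec (lookup xs x ≟ x)) ×-dec
      ¬? (all? λ x → lookup xs x ≟ x)

  -- Exhaustive search turns the bare negation into a witness. If it finds none, decidable equality
  -- makes every automorphism fixing `S` trivial.
  ¬determining⇒nontrivial : ∀ S → ¬ IsDetermining G S → ∃ λ g → g fixes S × ¬ (∀ x → g · x ≡ x)
  ¬determining⇒nontrivial S ¬det with any-vec? n (λ xs → any-vec? n (isAutFixing? S xs))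
  ... | yes (xs , ys , invˡ , invʳ , pres , fix , ¬triv) =
    record { perm = mk↔ₛ′ (lookup xs) (lookup ys) invˡ invʳ ; preserve = pres } , fix , ¬triv
  ... | no ∄ = contradiction (trivial⇒determining trivial) ¬det
    where
    trivial : ∀ h → h fixes S → ∀ x → h · x ≡ x
    trivial h fix = decidable-stable (all? λ x → h · x ≟ x) λ ¬triv →
      ∄ (tabulate (h ·_) , tabulate (h ⁻¹ ·_)
        , (λ x → trans (lk _) (trans (cong (h ·_) (lk _)) (·-⁻¹ h x)))
        , (λ x → trans (lk _) (trans (cong (h ⁻¹ ·_) (lk _)) (⁻¹-· h x)))
        , (λ x y → trans (cong₂ (adj G) (lk x) (lk y)) (preserve h x y))
        , (λ x x∈ → trans (lk x) (fix x x∈))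
        , λ triv → ¬triv λ x → trans (≡-sym (lk x)) (triv x))
      where
      lk : ∀ {f : Fin n → Fin n} x → lookup (tabulate f) x ≡ f x
      lk {f} = lookup∘tabulate f

-- Branches at a vertex and sides of an edge

module Tree {n} (T : Graph n) (tree : IsTree T) where

  open Automorphisms T

  connected : Connected T
  connected = proj₁ (proj₂ tree)

  acyclic : Acyclic T
  acyclic = proj₂ (proj₂ tree)

  infix 4 _~_ _↝[_]_

  _~_ : Fin n → Fin n → Set
  _~_ = Adj T

  ~-sym : ∀ {x y} → x ~ y → y ~ x
  ~-sym {x} {y} a = trans (≡-sym (sym T x y)) a

  ~⇒≢ : ∀ {x y} → x ~ y → x ≢ y
  ~⇒≢ {x} a refl with () ← trans (≡-sym a) (irrefl T x)

  StepAvoiding : Fin n → Fin n → Fin n → Set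
  StepAvoiding v x y = x ~ y × x ≢ v × y ≢ v

  _↝[_]_ : Fin n → Fin n → Fin n → Set
  x ↝[ v ] y = Star (StepAvoiding v) x y

  ↝-sym : ∀ {v x y} → x ↝[ v ] y → y ↝[ v ] x
  ↝-sym = reverse λ { (a , x≢v , y≢v) → ~-sym a , y≢v , x≢v }

  PathAvoiding : Fin n → Fin n → Fin n → Set
  PathAvoiding v x y =
    ∃ λ ws → Unique (x ∷ ws) × All (v ≢_) (x ∷ ws) × Chain T x ws × last x ws ≡ y

  -- Loop erasure: if the new starting vertex already occurs on the path, the path is cut back to
  -- that occurrence.
  suffix : ∀ {v x w y} ws → x ∈ˡ (w ∷ ws) → Unique (w ∷ ws) → All (v ≢_) (w ∷ ws) →
           Chain T w ws → last w ws ≡ y → PathAvoiding v x y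
  suffix ws       (here refl) u       a       ch       eq = ws , u , a , ch , eq
  suffix (z ∷ ws) (there x∈)  (_ ∷ u) (_ ∷ a) (_ , ch) eq = suffix ws x∈ u a ch eq

  path : ∀ {v x y} → v ≢ x → x ↝[ v ] y → PathAvoiding v x y
  path v≢x ε = [] , [] ∷ [] , v≢x ∷ [] , tt , refl
  path {x = x} v≢x (_◅_ {j = w} (a , _ , w≢v) p) with path (≢-sym w≢v) p
  ... | ws , u , av , ch , eq with _∈ˡ?_ _≟_ x (w ∷ ws)
  ...   | yes x∈ = suffix ws x∈ u av ch eq
  ...   | no  x∉ = w ∷ ws , ¬Any⇒All¬ (w ∷ ws) x∉ ∷ u , v≢x ∷ av , (a , ch) , eq

  -- A path from `c` to a different neighbour of `v` that avoids `v` would close up through `v` to a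
  -- cycle.
  neighbours-disconnected : ∀ {v c d} → v ~ c → v ~ d → c ↝[ v ] d → c ≡ d
  neighbours-disconnected {v} {c} v~c v~d p with path (~⇒≢ v~c) p
  ... | []     , _ , _  , _  , eq = eq
  ... | w ∷ ws , u , av , ch , eq = contradiction
    (av ∷ u , s≤s (s≤s z≤n) , (v~c , ch) , subst (_~ v) (≡-sym eq) (~-sym v~d))
    (acyclic v (c ∷ w ∷ ws))

  private
    first-hit : ∀ {v y} → y ≢ v → Walk T y v → ∃ λ c → v ~ c × y ↝[ v ] c
    first-hit y≢v (here _) = contradiction refl y≢v
    first-hit {v} {y} y≢v (step {w = w} a p) with w ≟ v
    ... | yes refl = y , ~-sym a , ε
    ... | no  w≢v with c , v~c , q ← first-hit w≢v p = c , v~c , (a , y≢v , w≢v) ◅ q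

  abstract
    -- The neighbour of v towards y, with the junk value v for y = v.
    next : Fin n → Fin n → Fin n
    next v y with y ≟ v
    ... | yes _   = v
    ... | no  y≢v = proj₁ (first-hit y≢v (connected y v))

    next-self : ∀ v → next v v ≡ v
    next-self v with v ≟ v
    ... | yes _   = refl
    ... | no  v≢v = contradiction refl v≢v

    next-spec : ∀ {v y} → y ≢ v → v ~ next v y × y ↝[ v ] next v y
    next-spec {v} {y} y≢v with y ≟ v
    ... | yes y≡v = contradiction y≡v y≢v
    ... | no  neq = proj₂ (first-hit neq (connected y v))

  next-unique : ∀ {v y c} → y ≢ v → v ~ c → y ↝[ v ] c → next v y ≡ c
  next-unique y≢v v~c p with v~d , q ← next-spec y≢v =
    neighbours-disconnected v~d v~c (↝-sym q ◅◅ p)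

  next-neighbour : ∀ {v c} → v ~ c → next v c ≡ c
  next-neighbour v~c = next-unique (≢-sym (~⇒≢ v~c)) v~c ε

  next-edge : ∀ {v x y} → x ~ y → x ≢ v → y ≢ v → next v x ≡ next v y
  next-edge x~y x≢v y≢v with v~d , q ← next-spec y≢v =
    next-unique x≢v v~d ((x~y , x≢v , y≢v) ◅ q)

  -- `next` is read off an arbitrary walk, so equivariance rests on `next-unique`: the image under
  -- `g` of a connection avoiding `v` avoids `g · v`.
  next-· : ∀ g v y → g · next v y ≡ next (g · v) (g · y)
  next-· g v y with y ≟ v
  ... | yes refl = trans (cong (g ·_) (next-self y)) (≡-sym (next-self (g · y)))
  ... | no  neq with v~c , p ← next-spec neq =
    ≡-sym (next-unique (neq ∘ ·-injective g) (·-adj g v~c)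
      (gmap (g ·_) (λ { (a , x≢ , y≢) → ·-adj g a , x≢ ∘ ·-injective g , y≢ ∘ ·-injective g }) p))

  next-≢ : ∀ {v c y} → v ~ c → next v y ≡ c → y ≢ v
  next-≢ {v} v~c eq refl = ~⇒≢ v~c (trans (≡-sym (next-self v)) eq)

  -- Induction along a walk from `y` to `v`: a step between vertices other than `v` keeps `next v`,
  -- and likewise for `c`. The ends `v` and `c` are immediate.
  edge-sides : ∀ {v c} → v ~ c → ∀ y → next v y ≡ c ⊎ next c y ≡ v
  edge-sides {v} {c} v~c y = go (connected y v)
    where
    go : ∀ {y} → Walk T y v → next v y ≡ c ⊎ next c y ≡ v
    go (here _) = inj₂ (next-neighbour (~-sym v~c))
    go {y} (step {w = w} a p) with y ≟ c | y ≟ v | go p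
    ... | yes refl | _        | _ = inj₁ (next-neighbour v~c)
    ... | no _     | yes refl | _ = inj₂ (next-neighbour (~-sym v~c))
    ... | no y≢c   | no y≢v   | inj₁ eq = inj₁ (trans (next-edge a y≢v (next-≢ v~c eq)) eq)
    ... | no y≢c   | no y≢v   | inj₂ eq = inj₂ (trans (next-edge a y≢c (next-≢ (~-sym v~c) eq)) eq)

  opposite-side : ∀ {v c y} → v ~ c → next v y ≢ c → next c y ≡ v
  opposite-side {y = y} v~c neq with edge-sides v~c y
  ... | inj₁ eq = contradiction eq neq
  ... | inj₂ eq = eq

  -- Lying on both sides would persist along a walk to `v` until it meets `v` or `c`, each of which
  -- lies on one side only.
  sides-disjoint : ∀ {v c} → v ~ c → ∀ {y} → next v y ≡ c → next c y ≢ v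
  sides-disjoint {v} {c} v~c {y} = go (connected y v)
    where
    go : ∀ {y} → Walk T y v → next v y ≡ c → next c y ≢ v
    go (here _) eq _ = next-≢ v~c eq refl
    go {y} (step {w = w} a p) eq₁ eq₂ with w ≟ v | w ≟ c
    ... | yes refl | _ = next-≢ (~-sym v~c) eq₂ (trans (≡-sym (next-neighbour (~-sym a))) eq₁)
    ... | no _ | yes refl = next-≢ v~c eq₁ (trans (≡-sym (next-neighbour (~-sym a))) eq₂)
    ... | no w≢v | no w≢c =
      go p (trans (≡-sym (next-edge a (next-≢ v~c eq₁) w≢v)) eq₁)
           (trans (≡-sym (next-edge a (next-≢ (~-sym v~c) eq₂) w≢c)) eq₂)

  -- `next v` is constant along an edge that misses `v`, so an edge can leave the side only by
  -- ending at `v`.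
  leave-side : ∀ {v c x y} → v ~ c → x ~ y → next v x ≡ c → next v y ≢ c → x ≡ c × y ≡ v
  leave-side {v} {c} {x} {y} v~c x~y x-in y-out with y ≟ v
  ... | yes refl = trans (≡-sym (next-neighbour (~-sym x~y))) x-in , refl
  ... | no  y≢v  = contradiction (trans (≡-sym (next-edge x~y (next-≢ v~c x-in) y≢v)) x-in) y-out

  -- A side of one edge containing neither end of another edge lies on one side of the latter.
  side-homogeneous : ∀ {v c v′ c′} → v ~ c → v′ ~ c′ → next v c′ ≢ c →
                     ∀ {x y} → next v x ≡ c → next v y ≡ c → next v′ y ≡ c′ → next v′ x ≡ c′
  side-homogeneous {v} {c} {v′} {c′} e e′ c′-out x-in y-in =
    go (connect x-in ◅◅ ↝-sym (connect y-in)) x-in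
    where
    connect : ∀ {x} → next v x ≡ c → x ↝[ v ] c
    connect x-in = subst (_ ↝[ v ]_) x-in (proj₂ (next-spec (next-≢ e x-in)))
    go : ∀ {x y} → x ↝[ v ] y → next v x ≡ c → next v′ y ≡ c′ → next v′ x ≡ c′
    go ε _ eq = eq
    go {x} (_◅_ {j = w} (a , x≢v , w≢v) p) x-in eq with next v′ x ≟ c′
    ... | yes x-in′ = x-in′
    ... | no  x-out′ =
      let w-in = trans (≡-sym (next-edge a x≢v w≢v)) x-in
          w≡c′ , _ = leave-side e′ (~-sym a) (go p w-in eq) x-out′
      in contradiction (subst (λ z → next v z ≡ c) w≡c′ w-in) c′-out

  side-· : ∀ h {v c y} → next v y ≡ c → next (h · v) (h · y) ≡ h · c
  side-· h {v} {y = y} eq = trans (≡-sym (next-· h v y)) (cong (h ·_) eq)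

  side-·⁻ : ∀ h {v c y} → next (h · v) (h · y) ≡ h · c → next v y ≡ c
  side-·⁻ h {v} {y = y} eq = ·-injective h (trans (next-· h v y) eq)

  -- Automorphisms glued from the branches at a fixed vertex

  module _ (v : Fin n) where

    branchwise : (Fin n → Aut T) → Fin n → Fin n
    branchwise K x = K (next v x) · x

    branchwise-adj : ∀ K → (∀ d → K d · v ≡ v) → ∀ {x y} → x ~ y → branchwise K x ~ branchwise K y
    branchwise-adj K K-v {x} {y} x~y with x ≟ v | y ≟ v
    ... | yes refl | _ =
      subst (_~ K (next v y) · y) (trans (K-v _) (≡-sym (K-v _))) (·-adj (K (next v y)) x~y)
    ... | no _ | yes refl =
      subst (K (next v x) · x ~_) (trans (K-v _) (≡-sym (K-v _))) (·-adj (K (next v x)) x~y)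
    ... | no x≢v | no y≢v =
      subst (λ d → K (next v x) · x ~ K d · y) (next-edge x~y x≢v y≢v) (·-adj (K (next v x)) x~y)

    branchwise-inverse : ∀ K L → (∀ d → K d · v ≡ v) → (∀ d x → L (K d · d) · K d · x ≡ x) →
                         ∀ x → branchwise L (branchwise K x) ≡ x
    branchwise-inverse K L K-v inv x =
      -- As `K d` fixes `v`, it sends the branch of `d` to the branch of `K d · d`; this is the
      -- index at which `L` has to undo `K d`.
      let d = next v x in
      trans (cong (λ e → L e · K d · x)
              (trans (cong (λ z → next z (K d · x)) (≡-sym (K-v d))) (≡-sym (next-· (K d) v x))))
            (inv d x)

    glue : ∀ K L → (∀ d → K d · v ≡ v) → (∀ d → L d · v ≡ v) →
           (∀ d x → L (K d · d) · K d · x ≡ x) → (∀ d x → K (L d · d) · L d · x ≡ x) → Aut T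
    glue K L K-v L-v invʳ invˡ = mkAut (branchwise K) (branchwise L)
      (branchwise-inverse L K L-v invˡ) (branchwise-inverse K L K-v invʳ)
      (branchwise-adj K K-v) (branchwise-adj L L-v)

  onBranch : Fin n → Aut T → Fin n → Aut T
  onBranch c h d with d ≟ c
  ... | yes _ = h
  ... | no  _ = ι

  onBranch-≡ : ∀ c h {d} → d ≡ c → onBranch c h d ≡ h
  onBranch-≡ c h {d} d≡c with d ≟ c
  ... | yes _   = refl
  ... | no  d≢c = contradiction d≡c d≢c

  onBranch-≢ : ∀ c h {d} → d ≢ c → onBranch c h d ≡ ι
  onBranch-≢ c h {d} d≢c with d ≟ c
  ... | yes d≡c = contradiction d≡c d≢c
  ... | no  _   = refl

  onBranch-fixes : ∀ {v} c h → h · v ≡ v → ∀ d → onBranch c h d · v ≡ v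
  onBranch-fixes c h hv d with d ≟ c
  ... | yes _ = hv
  ... | no  _ = refl

  onBranch-inverse : ∀ c h k → h · c ≡ c → (∀ x → k · h · x ≡ x) →
                     ∀ d x → onBranch c k (onBranch c h d · d) · onBranch c h d · x ≡ x
  onBranch-inverse c h k hc inv d x with d ≟ c
  ... | yes refl = trans (cong (λ f → f · h · x) (onBranch-≡ c k hc)) (inv x)
  ... | no  d≢c  = cong (_· x) (onBranch-≢ c k d≢c)

  -- Acts as `h` on the branch of `c` at `v` and as the identity elsewhere.
  restrict : ∀ v c h → h · v ≡ v → h · c ≡ c → Aut T
  restrict v c h hv hc = glue v (onBranch c h) (onBranch c (h ⁻¹))
    (onBranch-fixes c h hv) (onBranch-fixes c (h ⁻¹) (fix⇒fix⁻¹ h hv))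
    (onBranch-inverse c h (h ⁻¹) hc (⁻¹-· h))
    (onBranch-inverse c (h ⁻¹) h (fix⇒fix⁻¹ h hc) (·-⁻¹ h))

  swapping : Fin n → Aut T → Fin n → Aut T
  swapping c g d with d ≟ c | d ≟ g · c
  ... | yes _ | _     = g
  ... | no  _ | yes _ = g ⁻¹
  ... | no  _ | no  _ = ι

  module _ (c : Fin n) (g : Aut T) where

    swapping-fixes : ∀ {x} → g · x ≡ x → ∀ d → swapping c g d · x ≡ x
    swapping-fixes gx d with d ≟ c | d ≟ g · c
    ... | yes _ | _     = gx
    ... | no  _ | yes _ = fix⇒fix⁻¹ g gx
    ... | no  _ | no  _ = refl

    swapping-first : ∀ {d} → d ≡ c → swapping c g d ≡ g
    swapping-first {d} d≡c with d ≟ c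
    ... | yes _   = refl
    ... | no  d≢c = contradiction d≡c d≢c

    swapping-second : ∀ {d} → d ≢ c → d ≡ g · c → swapping c g d ≡ g ⁻¹
    swapping-second {d} d≢c d≡gc with d ≟ c | d ≟ g · c
    ... | yes d≡c | _       = contradiction d≡c d≢c
    ... | no  _   | yes _   = refl
    ... | no  _   | no d≢gc = contradiction d≡gc d≢gc

    swapping-other : ∀ {d} → d ≢ c → d ≢ g · c → swapping c g d ≡ ι
    swapping-other {d} d≢c d≢gc with d ≟ c | d ≟ g · c
    ... | yes d≡c | _        = contradiction d≡c d≢c
    ... | no  _   | yes d≡gc = contradiction d≡gc d≢gc
    ... | no  _   | no  _    = refl

    swapping-involutive : g · c ≢ c →
                          ∀ d x → swapping c g (swapping c g d · d) · swapping c g d · x ≡ x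
    swapping-involutive gc≢c d x with d ≟ c | d ≟ g · c
    ... | yes refl | _        = trans (cong (_· g · x) (swapping-second gc≢c refl)) (⁻¹-· g x)
    ... | no _     | yes refl = trans (cong (_· g ⁻¹ · x) (swapping-first (⁻¹-· g c))) (·-⁻¹ g x)
    ... | no d≢c   | no d≢gc  = cong (_· x) (swapping-other d≢c d≢gc)

    -- Acts as `g` on the branch of `c`, as `g ⁻¹` on that of `g · c`, and trivially on the others.
    swapBranches : ∀ {v} → g · v ≡ v → g · c ≢ c → Aut T
    swapBranches {v} gv gc≢c = glue v (swapping c g) (swapping c g)
      (swapping-fixes gv) (swapping-fixes gv) (swapping-involutive gc≢c) (swapping-involutive gc≢c)

  -- The middle of the path from a moved vertex to its image

  -- The two forms of `centre` reflect the parity of the distance from `r` to `g · r`: the middle of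
  -- the path is the vertex `v` or the edge joining `v` and `c`.
  record Halves (g : Aut T) (r : Fin n) : Set where
    field
      {v c}    : Fin n
      edge     : v ~ c
      r-in     : next v r ≡ c
      disjoint : ∀ {y} → next v y ≡ c → next v (g · y) ≢ c
      centre   : g · v ≡ v ⊎ (g · v ≡ c × g · c ≡ v)

  -- Otherwise `g` maps the side of `c` seen from `x` into itself, hence onto itself; it contains
  -- `g · x`, so it would contain `x`. For `c` equal to `g · x` this yields `g · g · x ≡ x`.
  turn-back : ∀ g {x c} → x ~ c → g · x ≢ x → next x (g · x) ≡ c → next (g · x) x ≡ g · c
  turn-back g {x} {c} x~c gx≢x eq = decidable-stable (next (g · x) x ≟ g · c) λ neq →
    let gc≢x = λ gc≡x → neq (subst (λ z → next (g · x) z ≡ g · c) gc≡x (next-neighbour gx~gc))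
        c-out = λ c-in → gx≢x (≡-sym (proj₂ (leave-side gx~gc (~-sym x~c) c-in neq)))
        gc-in = trans (≡-sym (next-edge gx~gc gx≢x gc≢x)) eq
        closed = λ y y-in → side-homogeneous gx~gc x~c c-out (side-· g y-in) (next-neighbour gx~gc) gc-in
    in next-≢ x~c (closed⇒closed⁻¹ (·-injective g) (λ y → next x y ≡ c) closed x eq) refl
    where
    gx~gc = ·-adj g x~c

  side : Fin n → Fin n → Subset n
  side v c = ⟦ (λ y → next v y ≟ c) ⟧

  side-⊂ : ∀ {x c d} → x ~ c → c ~ d → d ≢ x → side c d ⊂ side x c
  side-⊂ {x} {c} {d} x~c c~d d≢x =
      (λ y∈ → ∈⟦⟧⁺ inner? (opposite-side (~-sym x~c) λ eq →
                d≢x (trans (≡-sym (∈⟦⟧⁻ outer? y∈)) eq)))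
    , c , ∈⟦⟧⁺ inner? (next-neighbour x~c) , λ c∈ → next-≢ c~d (∈⟦⟧⁻ outer? c∈) refl
    where
    inner? = λ y → next x y ≟ c
    outer? = λ y → next c y ≟ d

  -- A walk from `r` to the middle: `x` is moved, `c` is the next vertex towards `g · x`, and `r`
  -- lies behind `x` as seen from `c`. It stops when `c` is fixed or equals `g · x`; otherwise it
  -- moves on to `c` and `side x c` shrinks.
  halves : ∀ g r → g · r ≢ r → Halves g r
  halves g r gr≢r = go gr≢r first-edge refl (opposite-side first-edge λ eq →
                        next-≢ first-edge eq refl) (⊂-wellFounded _)
    where
    first-edge = proj₁ (next-spec gr≢r)
    go : ∀ {x c} → g · x ≢ x → x ~ c → next x (g · x) ≡ c → next c r ≡ x →
         Acc _⊂_ (side x c) → Halves g r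
    go {x} {c} gx≢x x~c eq r-in (acc rs) with g · c ≟ c | c ≟ g · x
    -- The roles are reversed in the record: its `v` is `c` and its `c` is `x`, so that the half
    -- contains `r`.
    ... | yes gc≡c | _ = record
      { edge     = ~-sym x~c
      ; r-in     = r-in
      ; disjoint = λ {y} y-in gy-in → gx≢x (trans (≡-sym (side-· g y-in))
                     (trans (cong (λ z → next z (g · y)) gc≡c) gy-in))
      ; centre   = inj₁ gc≡c }
    ... | no _ | yes refl = record
      { edge     = ~-sym x~c
      ; r-in     = r-in
      ; disjoint = λ {y} y-in → sides-disjoint x~c
                     (trans (cong (λ z → next z (g · y)) (≡-sym gc≡x)) (side-· g y-in))
      ; centre   = inj₂ (gc≡x , refl) }
      where
      gc≡x : g · g · x ≡ x
      gc≡x = trans (≡-sym (turn-back g x~c gx≢x eq)) (next-neighbour (~-sym x~c))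
    ... | no gc≢c | no c≢gx = go gc≢c c~d refl
        (opposite-side c~d λ r-in′ → d≢x (trans (≡-sym r-in′) r-in))
        (rs (side-⊂ x~c c~d d≢x))
      where
      c~d : c ~ next c (g · c)
      c~d = proj₁ (next-spec gc≢c)
      d≢x : next c (g · c) ≢ x
      -- The adjacent vertices `g · x` and `g · c` lie on one branch at `c`, and `g · x` is not on
      -- that of `x`.
      d≢x eq′ = sides-disjoint x~c eq
        (trans (next-edge (·-adj g x~c) (≢-sym c≢gx) gc≢c) eq′)

  -- Stabilisers within a half and the action of g

  module _ {g r} (H : Halves g r) where
    open Halves H

    private
      In : Fin n → Set
      In y = next v y ≡ c

    -- The edges (v , c) and (h v , h c) would otherwise bound nested halves, or halves
    -- covering the tree; then h, h ⁻¹ or h ⁻¹ ⊙ g maps In properly into itself.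
    stabiliser-fixes-edge : ∀ h {s} → In s → h · s ≡ s → h · v ≡ v × h · c ≡ c
    stabiliser-fixes-edge h {s} s-in hs with next v (h · c) ≟ c | next v (h · v) ≟ c
    ... | yes hc-in | no hv-out with hc≡c , hv≡v ← leave-side edge (~-sym (·-adj h edge)) hc-in hv-out =
      hv≡v , hc≡c
    -- Here `h` inverts the edge and would move the fixed vertex `s` to the other side.
    ... | no hc-out | yes hv-in with hv≡c , hc≡v ← leave-side edge (·-adj h edge) hv-in hc-out =
      contradiction (trans (cong₂ next (≡-sym hv≡c) (≡-sym hs)) (trans (side-· h s-in) hc≡v))
                    (sides-disjoint edge s-in)
    ... | no hc-out | no hv-out = contradiction
      (closed⇒closed⁻¹ (·-injective (h ⁻¹)) In closed (h · c)
        (subst In (≡-sym (⁻¹-· h c)) (next-neighbour edge)))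
      hc-out
      where
      s-in′ : next (h · v) s ≡ h · c
      s-in′ = trans (cong (next (h · v)) (≡-sym hs)) (side-· h s-in)
      closed : ∀ y → In y → In (h ⁻¹ · y)
      closed y y-in = side-·⁻ h (trans (cong (next (h · v)) (·-⁻¹ h y))
        (side-homogeneous edge (·-adj h edge) hc-out y-in s-in s-in′))
    ... | yes hc-in | yes hv-in with next (h · v) v ≟ h · c
    ...   | no v-out = contradiction refl
      (next-≢ edge (closed⇒closed⁻¹ (·-injective h) In closed v hv-in))
      where
      closed : ∀ y → In y → In (h · y)
      closed y y-in = decidable-stable (next v (h · y) ≟ c) λ hy-out → v-out
        (side-homogeneous (~-sym edge) (·-adj h edge) (sides-disjoint edge hc-in)
          (next-neighbour (~-sym edge)) (opposite-side edge hy-out) (side-· h y-in))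
    -- The two halves cover the tree, so the image of `In` under `g` lies in that under `h`. Since
    -- `h ⁻¹ ⊙ g` sends `g ⁻¹ · s` to `s`, both `g ⁻¹ · s` and its image under `g` would be in `In`.
    ...   | yes v-in = contradiction (subst In (≡-sym (·-⁻¹ g s)) s-in)
      (disjoint (closed⇒closed⁻¹ (·-injective (h ⁻¹ ⊙ g)) In closed (g ⁻¹ · s)
        (subst In (≡-sym (trans (cong (h ⁻¹ ·_) (·-⁻¹ g s)) (fix⇒fix⁻¹ h hs))) s-in)))
      where
      closed : ∀ y → In y → In (h ⁻¹ · g · y)
      closed y y-in = side-·⁻ h (trans (cong (next (h · v)) (·-⁻¹ h (g · y)))
        (side-homogeneous (~-sym edge) (·-adj h edge) (sides-disjoint edge hc-in)
          (opposite-side edge (disjoint y-in)) (next-neighbour (~-sym edge)) v-in))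

    gc≢c : g · c ≢ c
    gc≢c gc≡c = disjoint (next-neighbour edge) (trans (cong (next v) gc≡c) (next-neighbour edge))

    module _ {R} (R-det : IsDetermining T R) (g-fix : g fixes (R - r)) where

      same-half⇒fixed : ∀ h {s y} → In s → In y → h · s ≡ s → h · y ≡ y
      same-half⇒fixed h {s} {y} s-in y-in hs with hv , hc ← stabiliser-fixes-edge h s-in hs =
        trans (≡-sym (cong (_· y) (onBranch-≡ c h y-in)))
          (·-injective g (trans (cong (λ z → g · k · z) (≡-sym (⁻¹-· g y)))
            (determining⇒trivial R-det (g ⊙ k ⊙ g ⁻¹) k-fix (g · y))))
        where
        k = restrict v c h hv hc
        outside-fixed : ∀ {z} → ¬ In (g ⁻¹ · z) → g · k · g ⁻¹ · z ≡ z
        outside-fixed {z} z-out =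
          trans (cong (λ f → g · f · g ⁻¹ · z) (onBranch-≢ c h z-out)) (·-⁻¹ g z)
        -- `k` itself may move `r`. Its conjugate moves only vertices of the image of `In` under
        -- `g`, which contains neither `r` nor a vertex fixed by `g`.
        k-fix : (g ⊙ k ⊙ g ⁻¹) fixes R
        k-fix q q∈R with q ≟ r
        ... | yes refl = outside-fixed λ q-in →
          disjoint q-in (subst In (≡-sym (·-⁻¹ g q)) r-in)
        ... | no q≢r = outside-fixed λ q-in →
          disjoint q-in (subst In (trans (fix⇒fix⁻¹ g gq) (≡-sym (·-⁻¹ g q))) q-in)
          where gq = g-fix q (x∈p∧x≢y⇒x∈p-y q∈R q≢r)

      -- Both maps agree on `R`: at `r` the swap acts as `g`, and a vertex fixed by `g` is fixed by
      -- each of `g`, `g ⁻¹` and `ι`.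
      g-is-swap : (gv : g · v ≡ v) → ∀ x → g · x ≡ swapBranches c g gv gc≢c · x
      g-is-swap gv = R-det g (swapBranches c g gv gc≢c) agree
        where
        agree : ∀ q → q ∈ R → g · q ≡ swapBranches c g gv gc≢c · q
        agree q q∈R with q ≟ r
        ... | yes refl = ≡-sym (cong (_· q) (swapping-first c g r-in))
        ... | no q≢r   = trans gq (≡-sym (swapping-fixes c g gq (next v q)))
          where gq = g-fix q (x∈p∧x≢y⇒x∈p-y q∈R q≢r)

      -- If `g` inverts the edge, it exchanges the two sides. Otherwise it is the swap, so a moved
      -- vertex outside `In` lies on the branch of `g · c`, where `g` acts as `g ⁻¹` and leads back
      -- to `In`.
      moved⇒in-half : ∀ {s} → g · s ≢ s → In s ⊎ In (g · s)
      moved⇒in-half {s} gs≢s with next v s ≟ c | centre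
      ... | yes s-in | _ = inj₁ s-in
      ... | no s-out | inj₂ (gv , gc) = inj₂
        (trans (cong (λ z → next z (g · s)) (≡-sym gc))
               (trans (side-· g (opposite-side edge s-out)) gv))
      ... | no s-out | inj₁ gv with next v s ≟ g · c
      ...   | yes s-in′ = inj₂ (trans (cong (next v) gs)
        (trans (cong (λ z → next z (g ⁻¹ · s)) (≡-sym (fix⇒fix⁻¹ g gv)))
               (trans (side-· (g ⁻¹) s-in′) (⁻¹-· g c))))
        where
        gs : g · s ≡ g ⁻¹ · s
        gs = trans (g-is-swap gv s) (cong (_· s) (swapping-second c g s-out s-in′))
      ...   | no s-out′ = contradiction
        (trans (g-is-swap gv s) (cong (_· s) (swapping-other c g s-out s-out′))) gs≢s

-- The exchange property

theorem13 : ∀ {n : ℕ} (T : Graph n) → IsTree T →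
    ∀ (S R : Subset n) → IsMinDetermining T S → IsMinDetermining T R →
    ∀ (r : Fin n) → r ∈ R →
    Σ (Fin n) (λ s → s ∈ S × IsMinDetermining T ((S - s) ∪ ⁅ r ⁆))
theorem13 {n} T tree S R S-min@(S-det , S-irr) (R-det , R-irr) r r∈R = conclusion
  where
  open Automorphisms T
  open Tree T tree

  nontrivial =
    ¬determining⇒nontrivial (R - r) (R-irr (R - r) (x∈p⇒p-x⊂p r∈R))
  g     = proj₁ nontrivial
  g-fix = proj₁ (proj₂ nontrivial)
  g≢1   = proj₂ (proj₂ nontrivial)

  gr≢r : g · r ≢ r
  gr≢r gr = g≢1 (determining⇒trivial R-det g g-fixes-R)
    where
    g-fixes-R : g fixes R
    g-fixes-R q q∈R with q ≟ r
    ... | yes refl = gr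
    ... | no q≢r = g-fix q (x∈p∧x≢y⇒x∈p-y q∈R q≢r)

  H = halves g r gr≢r
  open Halves H

  same : ∀ {x y} → next v x ≡ c → next v y ≡ c → SameStabiliser x y
  same x-in y-in h = same-half⇒fixed H R-det g-fix h x-in y-in , same-half⇒fixed H R-det g-fix h y-in x-in

  conclusion : Σ (Fin n) λ s → s ∈ S × IsMinDetermining T ((S - s) ∪ ⁅ r ⁆)
  conclusion with any? (λ s → (s ∈? S) ×-dec (next v s ≟ c))
  -- `s` has the stabiliser of `r`, so the identity serves as the carrying automorphism.
  ... | yes (s , s∈S , s-in) = s , s∈S , exchange S-min s∈S ι (λ _ _ → refl) (same s-in r-in)
  ... | no none with s , s∈S , gs≢s ← moved-vertex g S (λ fix → g≢1 (determining⇒trivial S-det g fix)) =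
    s , s∈S , exchange S-min s∈S g g-fixes-rest (same (moved s∈S gs≢s) r-in)
    where
    moved : ∀ {t} → t ∈ S → g · t ≢ t → next v (g · t) ≡ c
    moved {t} t∈S gt≢t with moved⇒in-half H R-det g-fix gt≢t
    ... | inj₁ t-in  = contradiction (t , t∈S , t-in) none
    ... | inj₂ gt-in = gt-in
    -- Two vertices of S moved by g would have equal stabilisers, so one of them is redundant.
    g-fixes-rest : g fixes (S - s)
    g-fixes-rest t t∈ = decidable-stable (g · t ≟ t) λ gt≢t →
      S-irr (S - t) (x∈p⇒p-x⊂p t∈S) (trivial⇒determining λ h fix →
        determining⇒trivial S-det h λ u u∈S → h-fixes h fix gt≢t u u∈S)
      where
      t∈S = p─q⊆p S ⁅ s ⁆ t∈
      h-fixes : ∀ h → h fixes (S - t) → g · t ≢ t → h fixes S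
      h-fixes h fix gt≢t u u∈S with u ≟ t
      ... | no u≢t = fix u (x∈p∧x≢y⇒x∈p-y u∈S u≢t)
      -- The vertices `g · s` and `g · u` are the ones in the half, so their stabilisers are
      -- compared at the conjugate of `h` by `g`.
      ... | yes refl = ·-injective g (trans (cong (λ z → g · h · z) (≡-sym (⁻¹-· g u)))
        (proj₁ (same (moved s∈S gs≢s) (moved u∈S gt≢t) (g ⊙ h ⊙ g ⁻¹))
          (cong (g ·_) (trans (cong (h ·_) (⁻¹-· g s))
            (fix s (x∈p∧x≢y⇒x∈p-y s∈S (≢-sym (x∈p-y⇒x≢y S t∈))))))))
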